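{- Let $k\ge 3$ be an integer. For all integers $m$ with $k<m$, $$W_c\!\left(k,\,3+\left\lceil\frac{(m-k)\cdot k}{k-1}\right\rceil\right)>mk.$$
   Context: For positive integers $k,N,d$ with $k\ge 3$, a $k$-term cyclic arithmetic progression mod $N$ with common difference $d$ is a $k$-element subset of $\mathbb{Z}_N=\mathbb{Z}/N\mathbb{Z}$ of the form $\{t,t+d,\ldots,t+(k-1)d\}$ for some $t\in\mathbb{Z}_N$ (so these $k$ elements are pairwise distinct mod $N$). An $r$-coloring of a set $S$ is a map $c:S\to\{1,\ldots,r\}$; a subset of $S$ is monochromatic if $c$ is constant on it. For integers $k\ge 3$, $r\ge 2$, the cyclic Van der Waerden number $W_c(k,r)$ is the smallest modulus $N$ such that for all positive integers $M\ge N$ and every $r$-coloring of $\mathbb{Z}_M$, there exists a monochromatic $k$-term cyclic arithmetic progression mod $M$ in $\mathbb{Z}_M$. (This number always exists.) -}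

module Defs where

open import Data.Nat using (ℕ; _+_; _*_; _∸_; _≤_; _<_; NonZero; >-nonZero; s≤s; z≤n)
open import Data.Nat.DivMod using (_mod_)
open import Data.Nat.Properties using (≤-trans; m<n⇒0<n∸m)
open import Data.Fin using (Fin; toℕ)
open import Data.Fin.Subset using (Subset; _∈_; ∣_∣)
open import Data.Product using (_×_; ∃-syntax)
open import Function.Bundles using (_⇔_)
open import Relation.Binary.PropositionalEquality using (_≡_)

-- ℤ/N is represented by Fin N (least residues), and r colors by Fin r.
term : {N : ℕ} .{{_ : NonZero N}} → Fin N → (d i : ℕ) → Fin N
term {N} t d i = (toℕ t + i * d) mod N

-- The cardinality condition is what forces the k terms to be distinct mod N.
IsCyclicAP : (k : ℕ) {N : ℕ} .{{_ : NonZero N}} (d : ℕ) → Subset N → Set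
IsCyclicAP k {N} d S =
  ∣ S ∣ ≡ k ×
  (∃[ t ] ∀ (x : Fin N) → x ∈ S ⇔ (∃[ i ] (i < k × x ≡ term t d i)))

Coloring : (N r : ℕ) → Set
Coloring N r = Fin N → Fin r

Monochromatic : {N r : ℕ} → Coloring N r → Subset N → Set
Monochromatic c S = ∀ x y → x ∈ S → y ∈ S → c x ≡ c y

EveryColoringHasAP : (k r M : ℕ) .{{_ : NonZero M}} → Set
EveryColoringHasAP k r M =
  (c : Coloring M r) →
  ∃[ d ] ∃[ S ] (0 < d × IsCyclicAP k d S × Monochromatic c S)

IsThreshold : (k r N : ℕ) → Set
IsThreshold k r N =
  0 < N × (∀ M .{{_ : NonZero M}} → N ≤ M → EveryColoringHasAP k r M)

-- W_c(k,r) is given by its graph: IsW-c k r W says W_c(k,r) = W.  It is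
-- single-valued by minimality; that a value exists is van der Waerden's
-- theorem, which is not part of the definition.
IsW-c : (k r W : ℕ) → Set
IsW-c k r W = IsThreshold k r W × (∀ N → IsThreshold k r N → W ≤ N)

k∸1-nonZero : ∀ {k} → 3 ≤ k → NonZero (k ∸ 1)
k∸1-nonZero 3≤k = >-nonZero (m<n⇒0<n∸m (≤-trans (s≤s (s≤s z≤n)) 3≤k))

{-# OPTIONS --safe #-}

-- Let n = k - 1 and N = mk, and choose p ≥ 2 with 2p ≤ r and m ≤ pn.  Cut the
-- cycle ℤ/N into p arcs of nearly equal length, and colour x by its arc together
-- with the parity of ⌊x/n⌋.  A monochromatic progression stays in one arc, of
-- length at most N/2, so its steps do not wrap around: it is an integer
-- progression with some difference e.  Since an arc has length at most nk, |e| ≤ n,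
-- so a step cannot jump over a block of length n; by parity all terms lie in one
-- block, which is impossible for k = n + 1 distinct terms.
module Submission where

open import Defs
open import Data.Nat using (ℕ; zero; suc; _+_; _*_; _∸_; _≤_; _<_; _>_; NonZero; >-nonZero; >-nonZero⁻¹; z≤n; s≤s; _⊔_; ∣_-_∣; _/_; _%_)
open import Data.Nat.DivMod using (_mod_; m≡m%n+[m/n]*n; m%n<n; /-monoˡ-≤; m/n*n≤m; m<n*o⇒m/o<n; n/n≡1; +-distrib-/-∣ʳ)
open import Data.Nat.Properties
import Data.Nat.Divisibility as ℕ∣
open import Data.Integer as ℤ using (ℤ; +_; ∣_∣)
import Data.Integer.Properties as ℤP
open import Data.Integer.DivMod using ([n/d]*d≤n)
open import Data.Integer.Divisibility.Signed using (divides; ∣⇒∣ᵤ)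
import Data.Integer.Divisibility.Signed as ℤ∣
open import Data.Integer.Tactic.RingSolver using (solve-∀)
open import Data.Rational as ℚ using (floor; ceiling; ↥_; ↧_)
import Data.Rational.Properties as ℚP
open import Data.Rational.Unnormalised as ℚᵘ using (*≡*; mkℚᵘ)
open import Data.Fin using (Fin; toℕ; fromℕ<; combine; inject≤)
open import Data.Fin.Properties using (toℕ<n; toℕ-injective; toℕ-fromℕ<; fromℕ<-injective; combine-injective; inject≤-injective)
open import Data.Fin.Subset as Subset using (Subset; _∈_; _⊆_; ⁅_⁆)
open import Data.Fin.Subset.Properties using (x∈⁅x⁆; ∣⁅x⁆∣≡1; p⊆q⇒∣p∣≤∣q∣)
open import Data.Product using (_×_; _,_; proj₁; proj₂; ∃-syntax)
open import Data.Sum using (inj₁; inj₂)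
open import Function.Bundles using (module Equivalence)
open import Relation.Nullary using (¬_; contradiction)
open import Relation.Binary.PropositionalEquality using (_≡_; _≢_; refl; sym; trans; cong; cong₂; subst; subst₂; module ≡-Reasoning)

-- Distances, blocks of length `n`, and constant differences.

∣+m-+n∣≡∣m-n∣ : ∀ m n → ∣ + m ℤ.- + n ∣ ≡ ∣ m - n ∣
∣+m-+n∣≡∣m-n∣ m n with ≤-total m n
... | inj₁ m≤n = trans (cong ∣_∣ (ℤP.m-n≡m⊖n m n)) (trans (ℤP.∣⊖∣-≤ m≤n) (sym (m≤n⇒∣m-n∣≡n∸m m≤n)))
... | inj₂ n≤m = begin
  ∣ + m ℤ.- + n ∣  ≡⟨ ℤP.∣i-j∣≡∣j-i∣ (+ m) (+ n) ⟩
  ∣ + n ℤ.- + m ∣  ≡⟨ cong ∣_∣ (ℤP.m-n≡m⊖n n m) ⟩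
  ∣ n ℤ.⊖ m ∣      ≡⟨ ℤP.∣⊖∣-≤ n≤m ⟩
  m ∸ n            ≡⟨ m≤n⇒∣m-n∣≡n∸m n≤m ⟨
  ∣ n - m ∣        ≡⟨ ∣-∣-comm n m ⟩
  ∣ m - n ∣        ∎
  where open ≡-Reasoning

/-≡⇒∣m-n∣<o : ∀ m n o .{{_ : NonZero o}} → m / o ≡ n / o → ∣ m - n ∣ < o
/-≡⇒∣m-n∣<o m n o eq = begin-strict
  ∣ m - n ∣                                      ≡⟨ cong₂ ∣_-_∣ (split m) (trans (split n) (cong (λ q → q * o + n % o) (sym eq))) ⟩
  ∣ (m / o) * o + m % o - (m / o) * o + n % o ∣  ≡⟨ ∣m+n-m+o∣≡∣n-o∣ ((m / o) * o) (m % o) (n % o) ⟩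
  ∣ m % o - n % o ∣                              ≤⟨ ∣m-n∣≤m⊔n (m % o) (n % o) ⟩
  m % o ⊔ n % o                                  <⟨ ⊔-pres-<m (m%n<n m o) (m%n<n n o) ⟩
  o                                              ∎
  where
  open ≤-Reasoning
  split : ∀ a → a ≡ (a / o) * o + a % o
  split a = trans (m≡m%n+[m/n]*n a o) (+-comm (a % o) _)

suc-changes-parity : ∀ a → a mod 2 ≢ suc a mod 2
suc-changes-parity zero          ()
suc-changes-parity (suc zero)    ()
-- Residues mod 2 are unchanged by two successors, and this holds by computation, so `eq` already is
-- the equation for `a`.
suc-changes-parity (suc (suc a)) eq = suc-changes-parity a eq

-- Moving up by at most `n` raises the quotient by at most one, and a rise of exactly one would flip
-- its parity.
block-unchanged-≤ : ∀ a b n .{{_ : NonZero n}} → a ≤ b → ∣ a - b ∣ ≤ n →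
                    (a / n) mod 2 ≡ (b / n) mod 2 → a / n ≡ b / n
block-unchanged-≤ a b n a≤b d≤n par with m≤n⇒m<n∨m≡n (/-monoˡ-≤ n a≤b)
... | inj₂ eq = eq
... | inj₁ lt = contradiction (trans par (cong (_mod 2) b/n≡)) (suc-changes-parity (a / n))
  where
  open ≤-Reasoning
  b/n≡ : b / n ≡ suc (a / n)
  b/n≡ = ≤-antisym (begin
    b / n          ≤⟨ /-monoˡ-≤ n (≤-trans (m≤n+∣n-m∣ b a) (+-monoʳ-≤ a d≤n)) ⟩
    (a + n) / n    ≡⟨ +-distrib-/-∣ʳ a ℕ∣.∣-refl ⟩
    a / n + n / n  ≡⟨ cong (λ z → a / n + z) (n/n≡1 n) ⟩
    a / n + 1      ≡⟨ +-comm (a / n) 1 ⟩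
    suc (a / n)    ∎) lt

block-unchanged : ∀ a b n .{{_ : NonZero n}} → ∣ a - b ∣ ≤ n →
                  (a / n) mod 2 ≡ (b / n) mod 2 → a / n ≡ b / n
block-unchanged a b n d≤n par with ≤-total a b
... | inj₁ a≤b = block-unchanged-≤ a b n a≤b d≤n par
... | inj₂ b≤a = sym (block-unchanged-≤ b a n b≤a (subst (_≤ n) (∣-∣-comm a b) d≤n) (sym par))

-- Two integers of absolute value below `N / 2` differ by less than `N`, and 0 is the only multiple
-- of `N` that small. This is what rules out wrapping around the cycle.
∣∧small⇒≡ : ∀ N .{{_ : NonZero N}} i j → + N ℤ∣.∣ i ℤ.- j →
            ∣ i ∣ * 2 < N → ∣ j ∣ * 2 < N → i ≡ j
∣∧small⇒≡ N i j N∣ i< j< with ∣ i ℤ.- j ∣ in eq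
... | zero  = ℤP.i-j≡0⇒i≡j i j (ℤP.∣i∣≡0⇒i≡0 eq)
... | suc d = contradiction (ℕ∣.∣⇒≤ (subst (N ℕ∣.∣_) eq (∣⇒∣ᵤ N∣))) (<⇒≱ (*-cancelʳ-< 2 _ _ (begin-strict
    suc d * 2                ≡⟨ cong (_* 2) eq ⟨
    ∣ i ℤ.- j ∣ * 2          ≤⟨ *-monoˡ-≤ 2 (ℤP.∣i-j∣≤∣i∣+∣j∣ i j) ⟩
    (∣ i ∣ + ∣ j ∣) * 2      ≡⟨ *-distribʳ-+ 2 ∣ i ∣ ∣ j ∣ ⟩
    ∣ i ∣ * 2 + ∣ j ∣ * 2    <⟨ +-mono-< i< j< ⟩
    N + N                    ≡⟨ trans (*-comm N 2) (cong (λ z → N + z) (+-identityʳ N)) ⟨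
    N * 2                    ∎)))
  where open ≤-Reasoning

constant-difference : (x : ℕ → ℤ) (e : ℤ) (n : ℕ) → (∀ i → i < n → x (suc i) ℤ.- x i ≡ e) →
                      x n ℤ.- x 0 ≡ + n ℤ.* e
constant-difference x e zero    step = ℤP.+-inverseʳ (x 0)
constant-difference x e (suc n) step = begin
  x (suc n) ℤ.- x 0                        ≡⟨ telescope (x (suc n)) (x n) (x 0) ⟩
  (x (suc n) ℤ.- x n) ℤ.+ (x n ℤ.- x 0)    ≡⟨ cong₂ ℤ._+_ (step n ≤-refl) (constant-difference x e n λ i i<n → step i (m<n⇒m<1+n i<n)) ⟩
  e ℤ.+ + n ℤ.* e                          ≡⟨ ℤP.suc-* (+ n) e ⟨
  + suc n ℤ.* e                            ∎
  where
  open ≡-Reasoning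
  telescope : ∀ a b c → a ℤ.- c ≡ (a ℤ.- b) ℤ.+ (b ℤ.- c)
  telescope = solve-∀

constant-on-initial : {A : Set} (f : ℕ → A) (n : ℕ) → (∀ i → i < n → f i ≡ f (suc i)) → f 0 ≡ f n
constant-on-initial f zero    step = refl
constant-on-initial f (suc n) step =
  trans (constant-on-initial f n λ i i<n → step i (m<n⇒m<1+n i<n)) (step n ≤-refl)

-- The colouring by arc and stripe.

module ArcColouring (n p N : ℕ) .{{_ : NonZero n}} .{{_ : NonZero N}}
                    (2≤p : 2 ≤ p) (N≤pnk : N ≤ p * (n * suc n)) where

  -- Scaling by `p` before dividing gives `p` arcs of nearly equal length whether or not `p` divides
  -- `N`.
  arc : ℕ → ℕ
  arc x = (x * p) / N

  stripe : ℕ → Fin 2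
  stripe x = (x / n) mod 2

  -- The bound stays multiplied by `p` because `N / p` need not be an integer.
  arc-diameter : ∀ x y → arc x ≡ arc y → ∣ x - y ∣ * p < N
  arc-diameter x y eq =
    subst (_< N) (sym (*-distribʳ-∣-∣ p x y)) (/-≡⇒∣m-n∣<o (x * p) (y * p) N eq)

  arc<p : ∀ (x : Fin N) → arc (toℕ x) < p
  arc<p x = m<n*o⇒m/o<n (subst (toℕ x * p <_) (*-comm N p)
              (*-monoˡ-< p {{>-nonZero (≤-trans (s≤s z≤n) 2≤p)}} (toℕ<n x)))

  coloring : ∀ {r} → p * 2 ≤ r → Coloring N r
  coloring 2p≤r x = inject≤ (combine (fromℕ< (arc<p x)) (stripe (toℕ x))) 2p≤r

  coloring-injective : ∀ {r} (2p≤r : p * 2 ≤ r) x y → coloring 2p≤r x ≡ coloring 2p≤r y →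
                       arc (toℕ x) ≡ arc (toℕ y) × stripe (toℕ x) ≡ stripe (toℕ y)
  coloring-injective 2p≤r x y eq
    with arc≡ , stripe≡ ← combine-injective (fromℕ< (arc<p x)) (stripe (toℕ x))
                            (fromℕ< (arc<p y)) (stripe (toℕ y))
                            (inject≤-injective 2p≤r 2p≤r _ _ eq)
    = fromℕ<-injective _ _ (arc<p x) (arc<p y) arc≡ , stripe≡

  -- The terms are indexed 0, …, n, so the progression has length k = n + 1.
  module _ (f : ℕ → ℕ)
           (cong-mod : ∀ i → + N ℤ∣.∣ (+ f (suc i) ℤ.- + f i) ℤ.- (+ f 1 ℤ.- + f 0))
           (same-arc : ∀ i j → i ≤ n → j ≤ n → arc (f i) ≡ arc (f j))
           (same-stripe : ∀ i j → i ≤ n → j ≤ n → stripe (f i) ≡ stripe (f j)) where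

    open ≤-Reasoning

    private
      0<n : 0 < n
      0<n = >-nonZero⁻¹ n

      e : ℤ
      e = + f 1 ℤ.- + f 0

      diameter : ∀ i j → i ≤ n → j ≤ n → ∣ + f i ℤ.- + f j ∣ * p < N
      diameter i j i≤n j≤n = subst (λ z → z * p < N) (sym (∣+m-+n∣≡∣m-n∣ (f i) (f j)))
                               (arc-diameter (f i) (f j) (same-arc i j i≤n j≤n))

      half : ∀ i j → i ≤ n → j ≤ n → ∣ + f i ℤ.- + f j ∣ * 2 < N
      half i j i≤n j≤n = ≤-<-trans (*-monoʳ-≤ ∣ + f i ℤ.- + f j ∣ 2≤p) (diameter i j i≤n j≤n)

      step : ∀ i → i < n → + f (suc i) ℤ.- + f i ≡ e
      -- Both differences join points of one arc, hence are below `N / 2`; being congruent mod `N`,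
      -- they agree as integers.
      step i i<n = ∣∧small⇒≡ N _ e (cong-mod i) (half (suc i) i i<n (<⇒≤ i<n)) (half 1 0 0<n z≤n)

      span : ∣ + f n ℤ.- + f 0 ∣ ≡ n * ∣ e ∣
      span = trans (cong ∣_∣ (constant-difference (λ i → + f i) e n step)) (ℤP.abs-* (+ n) e)

      ∣e∣≤n : ∣ e ∣ ≤ n
      -- The `n` steps span `n * ∣ e ∣` inside one arc. The strict diameter bound gives
      -- `∣ e ∣ < n + 1`, just short enough not to jump over a block.
      ∣e∣≤n = ≤-pred (*-cancelˡ-< (p * n) ∣ e ∣ (suc n) (begin-strict
        p * n * ∣ e ∣               ≡⟨ trans (*-assoc p n ∣ e ∣) (*-comm p (n * ∣ e ∣)) ⟩
        n * ∣ e ∣ * p               ≡⟨ cong (_* p) span ⟨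
        ∣ + f n ℤ.- + f 0 ∣ * p     <⟨ diameter n 0 ≤-refl z≤n ⟩
        N                           ≤⟨ N≤pnk ⟩
        p * (n * suc n)             ≡⟨ *-assoc p n (suc n) ⟨
        p * n * suc n               ∎))

      same-block : f 0 / n ≡ f n / n
      same-block = constant-on-initial (λ i → f i / n) n λ i i<n →
        block-unchanged (f i) (f (suc i)) n
          (subst (_≤ n) (trans (cong ∣_∣ (sym (step i i<n))) (trans (∣+m-+n∣≡∣m-n∣ (f (suc i)) (f i)) (∣-∣-comm (f (suc i)) (f i)))) ∣e∣≤n)
          (same-stripe i (suc i) (<⇒≤ i<n) i<n)

      e≡0 : e ≡ + 0
      -- The end terms share a block, so the span `n * ∣ e ∣` is below `n`.
      e≡0 = ℤP.∣i∣≡0⇒i≡0 (n<1⇒n≡0 (*-cancelˡ-< n ∣ e ∣ 1 (begin-strict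
        n * ∣ e ∣             ≡⟨ span ⟨
        ∣ + f n ℤ.- + f 0 ∣   ≡⟨ ∣+m-+n∣≡∣m-n∣ (f n) (f 0) ⟩
        ∣ f n - f 0 ∣         <⟨ /-≡⇒∣m-n∣<o (f n) (f 0) n (sym same-block) ⟩
        n                     ≡⟨ *-identityʳ n ⟨
        n * 1                 ∎)))

    monochromatic⇒constant : ∀ i → i ≤ n → f i ≡ f 0
    monochromatic⇒constant i i≤n = sym (constant-on-initial f i λ j j<i →
      sym (ℤP.+-injective (ℤP.i-j≡0⇒i≡j _ _ (trans (step j (≤-trans j<i i≤n)) e≡0))))

-- Cyclic progressions read as sequences of least residues.

toℕ-term : ∀ {N} .{{_ : NonZero N}} (t : Fin N) d i → toℕ (term t d i) ≡ (toℕ t + i * d) % N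
toℕ-term {N} t d i = toℕ-fromℕ< (m%n<n (toℕ t + i * d) N)

-- Each term is `τ + j δ` minus a multiple of `N`, so `τ` and `δ` cancel in the difference of two
-- steps. The reference is the first step rather than `d`, since passing to least residues can make
-- the integer step negative.
term-steps-congruent : ∀ {N} .{{_ : NonZero N}} (t : Fin N) d i →
  + N ℤ∣.∣ (+ toℕ (term t d (suc i)) ℤ.- + toℕ (term t d i)) ℤ.- (+ toℕ (term t d 1) ℤ.- + toℕ (term t d 0))
term-steps-congruent {N} t d i = divides ((Q i ℤ.- Q (suc i)) ℤ.- (Q 0 ℤ.- Q 1)) (begin
  (T (suc i) ℤ.- T i) ℤ.- (T 1 ℤ.- T 0)
    ≡⟨ cong₂ ℤ._-_ (cong₂ ℤ._-_ (T≡ (suc i)) (T≡ i)) (cong₂ ℤ._-_ (T≡ 1) (T≡ 0)) ⟩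
  _ ≡⟨ rearrange τ δ (+ i) (+ N) (Q (suc i)) (Q i) (Q 1) (Q 0) ⟩
  ((Q i ℤ.- Q (suc i)) ℤ.- (Q 0 ℤ.- Q 1)) ℤ.* + N ∎)
  where
  open ≡-Reasoning
  τ δ : ℤ
  τ = + toℕ t
  δ = + d
  T Q : ℕ → ℤ
  T j = + toℕ (term t d j)
  Q j = + ((toℕ t + j * d) / N)
  move : ∀ a q → a ≡ (a ℤ.+ q) ℤ.- q
  move = solve-∀
  T≡ : ∀ j → T j ≡ (τ ℤ.+ + j ℤ.* δ) ℤ.- Q j ℤ.* + N
  T≡ j = begin
    T j                                ≡⟨ cong +_ (toℕ-term t d j) ⟩
    + (v % N)                          ≡⟨ move (+ (v % N)) (Q j ℤ.* + N) ⟩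
    (+ (v % N) ℤ.+ Q j ℤ.* + N) ℤ.- Q j ℤ.* + N
      ≡⟨ cong (λ z → (+ (v % N) ℤ.+ z) ℤ.- Q j ℤ.* + N) (ℤP.pos-* (v / N) N) ⟨
    + (v % N + v / N * N) ℤ.- Q j ℤ.* + N
      ≡⟨ cong (λ z → + z ℤ.- Q j ℤ.* + N) (m≡m%n+[m/n]*n v N) ⟨
    + v ℤ.- Q j ℤ.* + N
      ≡⟨ cong (λ z → (τ ℤ.+ z) ℤ.- Q j ℤ.* + N) (ℤP.pos-* j d) ⟩
    (τ ℤ.+ + j ℤ.* δ) ℤ.- Q j ℤ.* + N  ∎
    where
    v : ℕ
    v = toℕ t + j * d
  rearrange : ∀ τ δ i N q₃ q₂ q₁ q₀ →
    ((τ ℤ.+ (+ 1 ℤ.+ i) ℤ.* δ ℤ.- q₃ ℤ.* N) ℤ.- (τ ℤ.+ i ℤ.* δ ℤ.- q₂ ℤ.* N))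
      ℤ.- ((τ ℤ.+ + 1 ℤ.* δ ℤ.- q₁ ℤ.* N) ℤ.- (τ ℤ.+ + 0 ℤ.* δ ℤ.- q₀ ℤ.* N))
    ≡ ((q₂ ℤ.- q₃) ℤ.- (q₀ ℤ.- q₁)) ℤ.* N
  rearrange = solve-∀

-- All terms of a monochromatic progression would coincide, putting `S` inside a singleton although
-- it has `n + 1 ≥ 2` elements.
¬everyColoringHasAP : ∀ n p N r .{{_ : NonZero n}} .{{_ : NonZero N}} →
  2 ≤ p → N ≤ p * (n * suc n) → p * 2 ≤ r → ¬ EveryColoringHasAP (suc n) r N
¬everyColoringHasAP n p N r 2≤p N≤pnk 2p≤r everyColoringHasAP = <⇒≱ (s≤s (>-nonZero⁻¹ n)) (begin
  suc n               ≡⟨ ∣S∣≡k ⟨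
  Subset.∣ S ∣        ≤⟨ p⊆q⇒∣p∣≤∣q∣ S⊆⁅t⁆ ⟩
  Subset.∣ ⁅ x 0 ⁆ ∣  ≡⟨ ∣⁅x⁆∣≡1 (x 0) ⟩
  1                   ∎)
  where
  open ≤-Reasoning
  open ArcColouring n p N 2≤p N≤pnk

  AP : ∃[ d ] ∃[ S ] (0 < d × IsCyclicAP (suc n) d S × Monochromatic (coloring 2p≤r) S)
  AP = everyColoringHasAP (coloring 2p≤r)

  d : ℕ
  d = proj₁ AP

  S : Subset N
  S = proj₁ (proj₂ AP)

  isAP : IsCyclicAP (suc n) d S
  isAP = proj₁ (proj₂ (proj₂ (proj₂ AP)))

  ∣S∣≡k : Subset.∣ S ∣ ≡ suc n
  ∣S∣≡k = proj₁ isAP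

  t : Fin N
  t = proj₁ (proj₂ isAP)

  x : ℕ → Fin N
  x = term t d

  x∈S : ∀ i → i ≤ n → x i ∈ S
  x∈S i i≤n = Equivalence.from (proj₂ (proj₂ isAP) (x i)) (i , s≤s i≤n , refl)

  same-colour : ∀ i j → i ≤ n → j ≤ n →
    arc (toℕ (x i)) ≡ arc (toℕ (x j)) × stripe (toℕ (x i)) ≡ stripe (toℕ (x j))
  same-colour i j i≤n j≤n = coloring-injective 2p≤r (x i) (x j)
    (proj₂ (proj₂ (proj₂ (proj₂ AP))) (x i) (x j) (x∈S i i≤n) (x∈S j j≤n))

  constant : ∀ i → i ≤ n → toℕ (x i) ≡ toℕ (x 0)
  constant = monochromatic⇒constant (λ i → toℕ (x i)) (term-steps-congruent t d)
    (λ i j i≤n j≤n → proj₁ (same-colour i j i≤n j≤n))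
    (λ i j i≤n j≤n → proj₂ (same-colour i j i≤n j≤n))

  S⊆⁅t⁆ : S ⊆ ⁅ x 0 ⁆
  S⊆⁅t⁆ {y} y∈S with i , i<k , refl ← Equivalence.to (proj₂ (proj₂ isAP) y) y∈S =
    subst (_∈ ⁅ x 0 ⁆) (sym (toℕ-injective (constant i (≤-pred i<k)))) (x∈⁅x⁆ (x 0))

-- Bounds for the ceiling of a fraction.

⌊p⌋*↧p≤↥p : ∀ p → floor p ℤ.* ↧ p ℤ.≤ ↥ p
⌊p⌋*↧p≤↥p p@record{} = [n/d]*d≤n (↥ p) (↧ p)

↥p≤⌈p⌉*↧p : ∀ p → ↥ p ℤ.≤ ceiling p ℤ.* ↧ p
↥p≤⌈p⌉*↧p p@record{} = subst₂ ℤ._≤_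
  (trans (cong ℤ.-_ (ℚP.↥-neg p)) (ℤP.neg-involutive (↥ p)))
  (trans (ℤP.neg-distribˡ-* (floor (ℚ.- p)) (↧ (ℚ.- p))) (cong (ceiling p ℤ.*_) (ℚP.↧-neg p)))
  (ℤP.neg-mono-≤ (⌊p⌋*↧p≤↥p (ℚ.- p)))

-- Normalisation may reduce `i / n`, so the bound for the reduced numerator and denominator is
-- carried back by cross-multiplication.
i≤⌈i/n⌉*n : ∀ i n .{{_ : NonZero n}} → i ℤ.≤ ceiling (i ℚ./ n) ℤ.* + n
i≤⌈i/n⌉*n i n@(suc n-1) with *≡* q≃i/n ← ℚP.toℚᵘ-fromℚᵘ (mkℚᵘ i n-1) =
  ℤP.*-cancelʳ-≤-pos i (c ℤ.* + n) (↧ q) (begin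
    i ℤ.* ↧ q              ≡⟨ cong (i ℤ.*_) (ℚP.↧ᵘ-toℚᵘ q) ⟨
    i ℤ.* ℚᵘ.↧ ℚ.toℚᵘ q    ≡⟨ q≃i/n ⟨
    ℚᵘ.↥ ℚ.toℚᵘ q ℤ.* + n  ≡⟨ cong (ℤ._* + n) (ℚP.↥ᵘ-toℚᵘ q) ⟩
    ↥ q ℤ.* + n            ≤⟨ ℤP.*-monoʳ-≤-nonNeg (+ n) (↥p≤⌈p⌉*↧p q) ⟩
    c ℤ.* ↧ q ℤ.* + n      ≡⟨ swap c (↧ q) (+ n) ⟩
    c ℤ.* + n ℤ.* ↧ q      ∎)
  where
  open ℤP.≤-Reasoning
  q : ℚ.ℚ
  q = i ℚ./ n
  c : ℤ
  c = ceiling q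
  swap : ∀ a b c → a ℤ.* b ℤ.* c ≡ a ℤ.* c ℤ.* b
  swap = solve-∀

-- Since `j > 0`, the fraction already exceeds `j`. This supplies one extra colour, turning the
-- constant 3 into 4.
j<⌈j*k/[k-1]⌉ : ∀ j n .{{_ : NonZero j}} .{{_ : NonZero n}} → + j ℤ.< ceiling ((+ j ℤ.* + suc n) ℚ./ n)
j<⌈j*k/[k-1]⌉ j n = ℤP.≰⇒> λ c≤j → <⇒≱ (*-monoʳ-< j (n<1+n n)) (ℤ.drop‿+≤+ (begin
  + (j * suc n)       ≡⟨ ℤP.pos-* j (suc n) ⟩
  + j ℤ.* + suc n     ≤⟨ i≤⌈i/n⌉*n (+ j ℤ.* + suc n) n ⟩
  ceiling ((+ j ℤ.* + suc n) ℚ./ n) ℤ.* + n ≤⟨ ℤP.*-monoʳ-≤-nonNeg (+ n) c≤j ⟩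
  + j ℤ.* + n         ≡⟨ ℤP.pos-* j n ⟨
  + (j * n)           ∎))
  where open ℤP.≤-Reasoning

-- The number of arcs and the lower bound.

-- Each of the `j / 2` additional arcs contributes `n ≥ 2` and so absorbs two units of `j`; the
-- first two give `2 * n ≥ n + 2`, leaving one unit for an odd `j`.
enough-arcs : ∀ j n → 2 ≤ n → suc n + j ≤ (2 + j / 2) * n
enough-arcs j n 2≤n = begin
  suc n + j                        ≤⟨ +-monoʳ-≤ (suc n) j≤ ⟩
  suc n + (1 + j / 2 * n)          ≡⟨ +-suc (suc n) (j / 2 * n) ⟩
  2 + n + j / 2 * n                ≤⟨ +-monoˡ-≤ (j / 2 * n) (+-monoˡ-≤ n 2≤n) ⟩
  n + n + j / 2 * n                ≡⟨ +-assoc n n (j / 2 * n) ⟩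
  (2 + j / 2) * n                  ∎
  where
  open ≤-Reasoning
  j≤ : j ≤ 1 + j / 2 * n
  j≤ = begin
    j                      ≡⟨ m≡m%n+[m/n]*n j 2 ⟩
    j % 2 + j / 2 * 2      ≤⟨ +-mono-≤ (≤-pred (m%n<n j 2)) (*-monoʳ-≤ (j / 2) 2≤n) ⟩
    1 + j / 2 * n          ∎

proposition4p8 : (k : ℕ) (3≤k : 3 ≤ k) (m : ℕ) → k < m →
    let instance _ = k∸1-nonZero 3≤k in
    ∀ r → + r ≡ + 3 ℤ.+ ceiling (((+ m ℤ.- + k) ℤ.* + k) ℚ./ (k ∸ 1)) →
    ∀ W → IsW-c k r W → W > m * k
proposition4p8 k@(suc n@(suc _)) (s≤s 2≤n) m k<m r r≡ W ((_ , threshold) , _) = ≰⇒> λ W≤mk →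
  -- If `W ≤ m * k`, the threshold property applies to the modulus `m * k` itself.
  ¬everyColoringHasAP n p (m * k) r (m≤m+n 2 (j / 2)) mk≤pnk 2p≤r (threshold (m * k) W≤mk)
  where
  j p : ℕ
  j = m ∸ k
  -- The largest `p` with `2 * p ≤ 4 + j`.
  p = 2 + j / 2

  instance
    j≢0 : NonZero j
    j≢0 = >-nonZero (m<n⇒0<n∸m k<m)
    m*k≢0 : NonZero (m * k)
    m*k≢0 = m*n≢0 m k {{>-nonZero (≤-<-trans z≤n k<m)}}

  m-k≡j : + m ℤ.- + k ≡ + j
  m-k≡j = trans (ℤP.m-n≡m⊖n m k) (ℤP.⊖-≥ (<⇒≤ k<m))

  mk≤pnk : m * k ≤ p * (n * k)
  mk≤pnk = begin
    m * k            ≡⟨ cong (_* k) (m+[n∸m]≡n (<⇒≤ k<m)) ⟨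
    (k + j) * k      ≤⟨ *-monoˡ-≤ k (enough-arcs j n 2≤n) ⟩
    p * n * k        ≡⟨ *-assoc p n k ⟩
    p * (n * k)      ∎
    where open ≤-Reasoning

  4+j≤r : 4 + j ≤ r
  4+j≤r = ℤ.drop‿+≤+ (begin
    + 3 ℤ.+ + suc j    ≤⟨ ℤP.+-monoʳ-≤ (+ 3) (ℤP.i<j⇒suc[i]≤j (j<⌈j*k/[k-1]⌉ j n)) ⟩
    + 3 ℤ.+ ceiling ((+ j ℤ.* + k) ℚ./ n)  ≡⟨ cong (λ z → + 3 ℤ.+ ceiling ((z ℤ.* + k) ℚ./ n)) m-k≡j ⟨
    + 3 ℤ.+ ceiling (((+ m ℤ.- + k) ℤ.* + k) ℚ./ n)  ≡⟨ r≡ ⟨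
    + r ∎)
    where open ℤP.≤-Reasoning

  2p≤r : p * 2 ≤ r
  2p≤r = ≤-trans (+-monoʳ-≤ 4 (m/n*n≤m j 2)) 4+j≤r
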